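{- Let $p$ be a prime, $r\ge 1$ an integer, $R=\mathbb{Z}/p^r\mathbb{Z}$, and let $P,Q\in R[\boldsymbol{x}^{\pm1}]$ be Laurent polynomials in $\boldsymbol{x}=(x_1,\dots,x_d)$. Let $\operatorname{dg}$ be any degree-like function on $R[\boldsymbol{x}^{\pm1}]$ and put $a=\operatorname{dg}(P)$, $b=\operatorname{dg}(Q)$. Run the state-construction procedure described in the context, in any of its three variants (linear, automatic, or scaling), starting from $(P_0,Q_0)=(P,Q)$. Then among the resulting states $A_i(n)=\operatorname{ct}[P_i(\boldsymbol{x})^nQ_i(\boldsymbol{x})]$ there are at most $r$ distinct Laurent polynomials $P_i$, and every $Q_i$ satisfies $$\operatorname{dg}(Q_i)\le p^{r-1}a-1+\max(0,\,b-a+1).$$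
   Context: For a Laurent polynomial $F=\sum_{\boldsymbol{k}\in\mathbb{Z}^d}a_{\boldsymbol{k}}\boldsymbol{x}^{\boldsymbol{k}}$, $\operatorname{ct}[F]=a_{\boldsymbol{0}}$ denotes its constant term, and the Cartier operator is $\Lambda_p\big[\sum_{\boldsymbol{k}}a_{\boldsymbol{k}}\boldsymbol{x}^{\boldsymbol{k}}\big]=\sum_{\boldsymbol{k}}a_{p\boldsymbol{k}}\boldsymbol{x}^{\boldsymbol{k}}$. A degree-like function is a map $\operatorname{dg}:R[\boldsymbol{x}^{\pm1}]\to\mathbb{Z}_{\ge0}$ such that $\operatorname{dg}(FG)\le\operatorname{dg}(F)+\operatorname{dg}(G)$ and $\operatorname{dg}(\Lambda_p[F])\le \operatorname{dg}(F)/p$ for all $F,G$ (e.g. total degree, or degree or low-degree in a fixed variable). A linear $p$-scheme for a sequence $A:\mathbb{Z}_{\ge0}\to R$ consists of sequences $A_0=A,A_1,\dots,A_m:\mathbb{Z}_{\ge0}\to R$ (the states) with $A_i(pn+k)=\sum_j\alpha^{(k)}_{i,j}A_j(n)$ for all $i$, all $k\in\{0,\dots,p-1\}$, all $n\ge0$, for some $\alpha^{(k)}_{i,j}\in R$. It is automatic if each right-hand side is $0$ or a single $A_j(n)$, and scaling if each right-hand side has at most one nonzero term. State-construction procedure: states are pairs $(P_i,Q_i)$ of Laurent polynomials over $R$, representing $A_i(n)=\operatorname{ct}[P_i^nQ_i]$, starting with $(P_0,Q_0)=(P,Q)$. For each existing state $i$ and each $k\in\{0,\dots,p-1\}$, set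 $\tilde P=P_i^p$, $\tilde Q=P_i^kQ_i$. If $\tilde P(\boldsymbol{x})=\hat P(\boldsymbol{x}^p)$ for some Laurent polynomial $\hat P$ over $R$, set $\hat Q=\Lambda_p[\tilde Q]$; otherwise set $\hat P=\tilde P$, $\hat Q=\tilde Q$. Then $A_i(pn+k)=\operatorname{ct}[\hat P^n\hat Q]$ in $R$. In the linear variant, if $\operatorname{ct}[\hat P^n\hat Q]$ is an $R$-linear combination of existing states of the form $\operatorname{ct}[\hat P^nQ_j]$ this is recorded as the transition; in the automatic variant one checks whether it equals an existing state; in the scaling variant whether it is an $R$-multiple of an existing state. If the check fails, $(\hat P,\hat Q)$ is added as a new state. The procedure continues until every state and every $k$ has been processed. -}

module Defs where

open import Data.Nat as ℕ using (ℕ; zero; suc; NonZero; _≤_; _∸_)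
open import Data.Integer as ℤ using (ℤ; +_; _/ℕ_; _%ℕ_)
open import Data.Integer.Divisibility using () renaming (_∣_ to _∣ℤ_)
open import Data.Vec as Vec using (Vec; replicate; zipWith)
open import Data.Vec.Properties using (≡-dec)
open import Data.List as List using (List; []; _∷_; concatMap; filter)
open import Data.Product using (_×_; _,_; Σ; ∃; ∃-syntax; proj₁; proj₂)
open import Data.Bool using (Bool; true; false; _∧_)
open import Data.Fin using (Fin)
open import Relation.Nullary using (¬_; does)
open import Relation.Binary.PropositionalEquality using (_≡_)

-- A Laurent polynomial in d variables with coefficients represented by
-- integers: a finite list of terms (exponent vector, coefficient).
-- The coefficient of x^k is the sum of the coefficients of the terms
-- with exponent vector k.  Elements of (ℤ/Nℤ)[x^{±1}] are represented
-- by integer Laurent polynomials up to the congruence _≈[_]_ below.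
LPoly : ℕ → Set
LPoly d = List (Vec ℤ d × ℤ)

coeff : ∀ {d} → LPoly d → Vec ℤ d → ℤ
coeff [] k = + 0
coeff ((e , c) ∷ F) k with ≡-dec ℤ._≟_ e k
... | Relation.Nullary.yes _ = c ℤ.+ coeff F k
... | Relation.Nullary.no _ = coeff F k

ct : ∀ {d} → LPoly d → ℤ
ct {d} F = coeff F (replicate d (+ 0))

_≈[_]_ : ∀ {d} → LPoly d → ℕ → LPoly d → Set
F ≈[ N ] G = ∀ k → (+ N) ∣ℤ (coeff F k ℤ.- coeff G k)

oneL : ∀ {d} → LPoly d
oneL {d} = (replicate d (+ 0) , + 1) ∷ []

_*L_ : ∀ {d} → LPoly d → LPoly d → LPoly d
F *L G = concatMap (λ t → List.map (λ s → (zipWith ℤ._+_ (proj₁ t) (proj₁ s) , proj₂ t ℤ.* proj₂ s)) G) F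

_^L_ : ∀ {d} → LPoly d → ℕ → LPoly d
F ^L zero = oneL
F ^L suc n = F *L (F ^L n)

expand : ∀ {d} → ℕ → LPoly d → LPoly d
expand p F = List.map (λ t → (Vec.map (ℤ._*_ (+ p)) (proj₁ t) , proj₂ t)) F

allDiv : ∀ {d} (p : ℕ) .{{_ : NonZero p}} → Vec ℤ d → Bool
allDiv p Vec.[] = true
allDiv p (z Vec.∷ e) = does (z %ℕ p ℕ.≟ 0) ∧ allDiv p e

Λ : ∀ {d} (p : ℕ) .{{_ : NonZero p}} → LPoly d → LPoly d
Λ p [] = []
Λ p ((e , c) ∷ F) with allDiv p e
... | true = (Vec.map (λ z → z /ℕ p) e , c) ∷ Λ p F
... | false = Λ p F

record DegreeLike (d p N : ℕ) .{{_ : NonZero p}} : Set where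
  field
    dg     : LPoly d → ℕ
    dg-cong : ∀ F G → F ≈[ N ] G → dg F ≡ dg G
    dg-mul : ∀ F G → dg (F *L G) ≤ dg F ℕ.+ dg G
    dg-Λ   : ∀ F → dg (Λ p F) ℕ.* p ≤ dg F

data Reach {d : ℕ} (p N : ℕ) .{{_ : NonZero p}} (P Q : LPoly d) : LPoly d → LPoly d → Set where
  start : Reach p N P Q P Q
  stepΛ : ∀ {Pi Qi} → Reach p N P Q Pi Qi → (k : ℕ) → k ℕ.< p →
          (P̂ : LPoly d) → (Pi ^L p) ≈[ N ] expand p P̂ →
          Reach p N P Q P̂ (Λ p ((Pi ^L k) *L Qi))
  stepPlain : ∀ {Pi Qi} → Reach p N P Q Pi Qi → (k : ℕ) → k ℕ.< p →
          ¬ (∃[ P̂ ] ((Pi ^L p) ≈[ N ] expand p P̂)) →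
          Reach p N P Q (Pi ^L p) ((Pi ^L k) *L Qi)

{-# OPTIONS --safe #-}
-- By Frobenius, P^p ≡ P(x^p) mod p, and congruences mod n with p ∣ n are
-- raised to congruences mod p n by p-th powers, so
-- P^(p^(i+1)) ≡ P(x^p)^(p^i) mod p^(i+1).  If G is the polynomial reached after
-- i steps, of which c contracted, then G(x^(p^c)) ≡ P^(p^i).  For i = r - 1 the
-- key congruence says that G^p ≡ G(x^p) mod p^r: from then on every step
-- contracts and G no longer changes.  Hence at most r different polynomials
-- occur, and at most r - 1 steps take a p-th power.  The degree bound on Q
-- follows by induction along the steps, with p^(r-1) a replaced by p^i a, where
-- i is the number of steps so far, capped at r - 1.
module Submission where

open import Defs
open import Algebra.Bundles using (CommutativeSemiring)
open import Algebra.Structures.Biased using (IsCommutativeSemiringˡ; IsCommutativeMonoidˡ)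
open import Data.Bool using (true)
open import Data.Fin as Fin using (Fin; toℕ; fromℕ; fromℕ<; inject₁)
open import Data.Fin.Properties using (toℕ-fromℕ; toℕ-fromℕ<; toℕ-inject₁; toℕ<n; injective⇒≤)
open import Data.Integer as ℤ using (ℤ; +_; _%ℕ_; _/ℕ_; 0ℤ; 1ℤ)
import Data.Integer.DivMod as ℤ
import Data.Integer.Divisibility as Unsigned
import Data.Integer.Divisibility.Signed as Signed
import Data.Integer.Properties as ℤ
import Data.Integer.Tactic.RingSolver as ℤ-Solver
open import Data.List as List using (List; []; _∷_; _++_; deduplicate)
import Data.List.Properties as List
open import Data.List.Membership.Propositional using (_∈_)
open import Data.List.Membership.Propositional.Properties using (∈-deduplicate⁺)
open import Data.List.Relation.Unary.All as All using (All; []; _∷_)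
open import Data.List.Relation.Unary.AllPairs using ([]; _∷_)
open import Data.List.Relation.Unary.Any using (here; there)
open import Data.List.Relation.Unary.Unique.DecPropositional.Properties using (deduplicate-!)
open import Data.List.Relation.Unary.Unique.Propositional using (Unique)
open import Data.Nat as ℕ using (ℕ; zero; suc; _≤_; _<_; _∸_; NonZero)
open import Data.Nat.Combinatorics using (_C_; nCn≡1; k>n⇒nCk≡0; nCk+nC[k+1]≡[n+1]C[k+1])
open import Data.Nat.Divisibility using (_∣_; divides; m∣m*n; ∣⇒≤)
open import Data.Nat.Primality using (Prime; euclidsLemma; prime⇒nonTrivial)
import Data.Nat.Properties as ℕ
import Data.Nat.Tactic.RingSolver as ℕ-Solver
open import Data.Product using (∃-syntax; _,_; proj₁; proj₂)
open import Data.Sum using (inj₁; inj₂)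
open import Data.Vec as Vec using (Vec; []; _∷_; zipWith; replicate)
import Data.Vec.Properties as Vec
open import Function using (_∘_)
open import Level using (_⊔_)
open import Relation.Binary.Definitions using (DecidableEquality)
open import Relation.Binary.PropositionalEquality as ≡
  using (_≡_; _≢_; cong; cong₂; subst; module ≡-Reasoning)
open import Relation.Binary.Structures using (IsEquivalence)
open import Relation.Nullary using (¬_; yes; no; contradiction)

private
  variable
    d N : ℕ

-- Binomial coefficients divisible by a prime.

[1+k]*[1+n]C[1+k]≡[1+n]*nCk : ∀ n k → suc k ℕ.* (suc n C suc k) ≡ suc n ℕ.* (n C k)
[1+k]*[1+n]C[1+k]≡[1+n]*nCk zero zero = ≡.refl
[1+k]*[1+n]C[1+k]≡[1+n]*nCk zero (suc k)
  rewrite k>n⇒nCk≡0 {1} {suc (suc k)} (ℕ.s<s ℕ.z<s)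
        | k>n⇒nCk≡0 {0} {suc k} ℕ.z<s = ℕ.*-zeroʳ (suc (suc k))
[1+k]*[1+n]C[1+k]≡[1+n]*nCk (suc n) zero = begin
  1 ℕ.* (suc (suc n) C 1)                ≡⟨ ℕ.*-identityˡ _ ⟩
  suc (suc n) C 1                        ≡⟨ nCk+nC[k+1]≡[n+1]C[k+1] (suc n) 0 ⟨
  1 ℕ.+ (suc n C 1)                      ≡⟨ cong suc (ℕ.*-identityˡ (suc n C 1)) ⟨
  1 ℕ.+ 1 ℕ.* (suc n C 1)                ≡⟨ cong suc ([1+k]*[1+n]C[1+k]≡[1+n]*nCk n zero) ⟩
  suc (suc n) ℕ.* 1                      ∎
  where open ≡.≡-Reasoning
[1+k]*[1+n]C[1+k]≡[1+n]*nCk (suc n) (suc k) = begin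
  suc (suc k) ℕ.* (suc (suc n) C suc (suc k))
    ≡⟨ cong (suc (suc k) ℕ.*_) (nCk+nC[k+1]≡[n+1]C[k+1] (suc n) (suc k)) ⟨
  suc (suc k) ℕ.* (c ℕ.+ (suc n C suc (suc k)))
    ≡⟨ ℕ.*-distribˡ-+ (suc (suc k)) c _ ⟩
  suc (suc k) ℕ.* c ℕ.+ suc (suc k) ℕ.* (suc n C suc (suc k))
    ≡⟨ cong₂ (λ u v → c ℕ.+ u ℕ.+ v) ([1+k]*[1+n]C[1+k]≡[1+n]*nCk n k) ([1+k]*[1+n]C[1+k]≡[1+n]*nCk n (suc k)) ⟩
  c ℕ.+ suc n ℕ.* (n C k) ℕ.+ suc n ℕ.* (n C suc k)
    ≡⟨ ℕ.+-assoc c _ _ ⟩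
  c ℕ.+ (suc n ℕ.* (n C k) ℕ.+ suc n ℕ.* (n C suc k))
    ≡⟨ cong (c ℕ.+_) (ℕ.*-distribˡ-+ (suc n) (n C k) (n C suc k)) ⟨
  c ℕ.+ suc n ℕ.* ((n C k) ℕ.+ (n C suc k))
    ≡⟨ cong (λ u → c ℕ.+ suc n ℕ.* u) (nCk+nC[k+1]≡[n+1]C[k+1] n k) ⟩
  suc (suc n) ℕ.* c ∎
  where
  open ≡.≡-Reasoning
  c = suc n C suc k

-- The absorption identity shows `p` dividing `k` times `p C k`; as `0 < k < p`, Euclid's lemma
-- leaves only the second factor.
prime∣pCk : ∀ {p k} → Prime p → 0 < k → k < p → p ∣ p C k
prime∣pCk {suc q} {suc k} pr _ k<p
  with euclidsLemma (suc k) (suc q C suc k) pr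
         (subst (suc q ∣_) (≡.sym ([1+k]*[1+n]C[1+k]≡[1+n]*nCk q k)) (m∣m*n (q C k)))
... | inj₁ p∣k = contradiction (∣⇒≤ p∣k) (ℕ.<⇒≱ k<p)
... | inj₂ p∣C = p∣C

-- Congruences modulo n in a commutative semiring, and their p-th powers.

module Congruence {c ℓ} (S : CommutativeSemiring c ℓ) where
  open CommutativeSemiring S
  open import Algebra.Properties.Semiring.Mult semiring
    using (_×_; ×-congʳ; ×-congˡ; ×-assocˡ; ×-assoc-*; ×-comm-*; ×-homo-1)
  open import Algebra.Properties.CommutativeMonoid.Mult +-commutativeMonoid using (×-distrib-+)
  open import Algebra.Properties.CommutativeSemiring.Exp S using (_^_; ^-congˡ; ^-congʳ)
  open import Algebra.Properties.CommutativeSemiring.Binomial S as Binomial using (binomialTerm)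
  open import Algebra.Properties.Semiring.Sum semiring using (sum; sum-init-last)
  open import Algebra.Properties.CommutativeSemigroup +-commutativeSemigroup using (interchange)
  open import Relation.Binary.Reasoning.Setoid setoid

  infix 4 _≡_[mod_]
  -- Without subtraction the relation is one-sided: `x` exceeds `y` by an explicit multiple of `n`.
  -- Symmetry for Laurent polynomials comes later, in `mod-sym`, by way of coefficients.
  record _≡_[mod_] (x y : Carrier) (n : ℕ) : Set (c ⊔ ℓ) where
    constructor _,_
    field
      quotient : Carrier
      equality : x ≈ y + n × quotient

  mod-reflexive : ∀ {x y n} → x ≈ y → x ≡ y [mod n ]
  mod-reflexive {x} {y} {n} x≈y = 0# , (begin
    x              ≈⟨ x≈y ⟩
    y              ≈⟨ +-identityʳ y ⟨
    y + 0#         ≈⟨ +-congˡ (zeroˡ _) ⟨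
    y + 0# * (n × 0#) ≈⟨ +-congˡ (×-comm-* n 0# 0#) ⟩
    y + n × (0# * 0#) ≈⟨ +-congˡ (×-congʳ n (zeroˡ 0#)) ⟩
    y + n × 0#     ∎)

  mod-trans : ∀ {x y z n} → x ≡ y [mod n ] → y ≡ z [mod n ] → x ≡ z [mod n ]
  mod-trans {x} {y} {z} {n} (h , x≈) (k , y≈) = k + h , (begin
    x                    ≈⟨ x≈ ⟩
    y + n × h            ≈⟨ +-congʳ y≈ ⟩
    z + n × k + n × h    ≈⟨ +-assoc _ _ _ ⟩
    z + (n × k + n × h)  ≈⟨ +-congˡ (×-distrib-+ k h n) ⟨
    z + n × (k + h)      ∎)

  mod-+-cong : ∀ {x y z w n} → x ≡ y [mod n ] → z ≡ w [mod n ] → x + z ≡ y + w [mod n ]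
  mod-+-cong {x} {y} {z} {w} {n} (h , x≈) (k , z≈) = h + k , (begin
    x + z                      ≈⟨ +-cong x≈ z≈ ⟩
    y + n × h + (w + n × k)    ≈⟨ interchange _ _ _ _ ⟩
    y + w + (n × h + n × k)    ≈⟨ +-congˡ (×-distrib-+ h k n) ⟨
    y + w + n × (h + k)        ∎)

  mod-*-congˡ : ∀ {x y n} z → x ≡ y [mod n ] → z * x ≡ z * y [mod n ]
  mod-*-congˡ {x} {y} {n} z (h , x≈) = z * h , (begin
    z * x                ≈⟨ *-congˡ x≈ ⟩
    z * (y + n × h)      ≈⟨ distribˡ _ _ _ ⟩
    z * y + z * (n × h)  ≈⟨ +-congˡ (×-comm-* n z h) ⟩
    z * y + n × (z * h)  ∎)

  mod-*-cong : ∀ {x y z w n} → x ≡ y [mod n ] → z ≡ w [mod n ] → x * z ≡ y * w [mod n ]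
  mod-*-cong {x} {y} {z} {w} x≡y z≡w =
    mod-trans (mod-*-congˡ x z≡w)
      (mod-trans (mod-reflexive (*-comm x w))
        (mod-trans (mod-*-congˡ w x≡y) (mod-reflexive (*-comm w y))))

  mod-^-cong : ∀ {x y n} k → x ≡ y [mod n ] → x ^ k ≡ y ^ k [mod n ]
  mod-^-cong zero    x≡y = mod-reflexive refl
  mod-^-cong (suc k) x≡y = mod-*-cong x≡y (mod-^-cong k x≡y)

  module _ {p : ℕ} (p-prime : Prime p) where

    private
      Multiple : Carrier → Carrier → Set _
      Multiple y x = ∃[ z ] x ≈ p × (y * z)

      sum-multiple : ∀ {y n} (t : Fin n → Carrier) → (∀ i → Multiple y (t i)) → Multiple y (sum t)
      sum-multiple {y} {zero} t mult = 0# , (begin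
        0#                  ≈⟨ zeroʳ _ ⟨
        (p × y) * 0#        ≈⟨ ×-assoc-* p y 0# ⟩
        p × (y * 0#)        ∎)
      sum-multiple {y} {suc n} t mult
        with z , t₀≈ ← mult Fin.zero | w , ts≈ ← sum-multiple (t ∘ Fin.suc) (mult ∘ Fin.suc) = z + w , (begin
        t Fin.zero + sum (t ∘ Fin.suc)  ≈⟨ +-cong t₀≈ ts≈ ⟩
        p × (y * z) + p × (y * w)       ≈⟨ ×-distrib-+ _ _ p ⟨
        p × (y * z + y * w)             ≈⟨ ×-congʳ p (distribˡ y z w) ⟨
        p × (y * (z + w))               ∎)

      -- The factor `p` comes from the binomial coefficient; since `k < p`, the exponent of `y` is
      -- positive and one factor `y` can be split off.
      term-multiple : ∀ x y {k} → 0 < k → k < p → Multiple y ((p C k) × (x ^ k * y ^ (p ∸ k)))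
      term-multiple x y {k} 0<k k<p with divides q eq ← prime∣pCk p-prime 0<k k<p = q × (x ^ k * w) , (begin
        (p C k) × (x ^ k * y ^ (p ∸ k))   ≈⟨ ×-congˡ (≡.trans eq (ℕ.*-comm q p)) ⟩
        (p ℕ.* q) × (x ^ k * y ^ (p ∸ k)) ≈⟨ ×-assocˡ _ p q ⟨
        p × q × (x ^ k * y ^ (p ∸ k))     ≈⟨ ×-congʳ p (×-congʳ q (begin
          x ^ k * y ^ (p ∸ k)  ≈⟨ *-congˡ (^-congʳ y (≡.sym (ℕ.suc-pred (p ∸ k) {{ℕ.>-nonZero (ℕ.m<n⇒0<n∸m k<p)}}))) ⟩
          x ^ k * (y * w)      ≈⟨ *-assoc _ _ _ ⟨
          x ^ k * y * w        ≈⟨ *-congʳ (*-comm _ _) ⟩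
          y * x ^ k * w        ≈⟨ *-assoc _ _ _ ⟩
          y * (x ^ k * w)      ∎)) ⟩
        p × q × (y * (x ^ k * w))         ≈⟨ ×-congʳ p (×-comm-* q y _) ⟨
        p × (y * q × (x ^ k * w))         ∎)
        where w = y ^ ℕ.pred (p ∸ k)

    -- The factor y in the last term is what turns a congruence mod n into one
    -- mod p n in mod-^p-lift, where y is a multiple of n.
    [x+y]^p≈x^p+y^p+pyz : ∀ x y → ∃[ z ] (x + y) ^ p ≈ x ^ p + y ^ p + p × (y * z)
    [x+y]^p≈x^p+y^p+pyz x y = go p ≡.refl
      where
      -- The auxiliary `n` allows matching on the exponent although `p` is fixed: as a successor it
      -- splits the binomial sum into first term, middle terms and last term.
      go : ∀ n → n ≡ p → ∃[ z ] (x + y) ^ n ≈ x ^ n + y ^ n + p × (y * z)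
      go zero ≡.refl with () ← prime⇒nonTrivial p-prime
      go (suc q) ≡.refl
        with z , mid≈ ← sum-multiple {y} (λ i → binomialTerm x y p (Fin.suc (inject₁ i)))
               (λ i → term-multiple x y ℕ.z<s (ℕ.s<s (subst (_< q) (≡.sym (toℕ-inject₁ i)) (toℕ<n i)))) = z , (begin
        (x + y) ^ p                   ≈⟨ Binomial.theorem p x y ⟩
        t Fin.zero + sum (t ∘ Fin.suc)  ≈⟨ +-cong first (sum-init-last (t ∘ Fin.suc)) ⟩
        y ^ p + (sum (λ i → t (Fin.suc (inject₁ i))) + t (fromℕ p))  ≈⟨ +-congˡ (+-cong mid≈ last) ⟩
        y ^ p + (p × (y * z) + x ^ p)   ≈⟨ +-congˡ (+-comm _ _) ⟩
        y ^ p + (x ^ p + p × (y * z))   ≈⟨ +-assoc _ _ _ ⟨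
        y ^ p + x ^ p + p × (y * z)     ≈⟨ +-congʳ (+-comm _ _) ⟩
        x ^ p + y ^ p + p × (y * z)     ∎)
        where
        t = binomialTerm x y p
        first : t Fin.zero ≈ y ^ p
        first = trans (×-homo-1 _) (*-identityˡ _)
        last : t (fromℕ p) ≈ x ^ p
        last rewrite toℕ-fromℕ q | nCn≡1 p | ℕ.n∸n≡0 q = trans (×-homo-1 _) (*-identityʳ _)

    mod-frobenius-+ : ∀ x y → (x + y) ^ p ≡ x ^ p + y ^ p [mod p ]
    mod-frobenius-+ x y with z , eq ← [x+y]^p≈x^p+y^p+pyz x y = y * z , eq

    -- Expanding `(y + n h)^p` leaves two errors. The mixed terms carry `p n` already; the pure
    -- power `(n h)^p` is a multiple of `n²`, which `p n` divides because `p ∣ n`.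
    mod-^p-lift : ∀ {x y n} → p ∣ n → x ≡ y [mod n ] → x ^ p ≡ y ^ p [mod p ℕ.* n ]
    mod-^p-lift {x} {y} {n} (divides m n≡m*p) (h , x≈) with z , eq ← [x+y]^p≈x^p+y^p+pyz y (n × h) = v + h * z , (begin
      x ^ p                                        ≈⟨ ^-congˡ p x≈ ⟩
      (y + n × h) ^ p                              ≈⟨ eq ⟩
      y ^ p + (n × h) ^ p + p × (n × h * z)        ≈⟨ +-assoc _ _ _ ⟩
      y ^ p + ((n × h) ^ p + p × (n × h * z))      ≈⟨ +-congˡ (+-cong (^p-multiple p ≡.refl) (begin
        p × (n × h * z)    ≈⟨ ×-congʳ p (×-assoc-* n h z) ⟩
        p × n × (h * z)    ≈⟨ ×-assocˡ _ p n ⟩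
        (p ℕ.* n) × (h * z) ∎)) ⟩
      y ^ p + ((p ℕ.* n) × v + (p ℕ.* n) × (h * z)) ≈⟨ +-congˡ (×-distrib-+ _ _ (p ℕ.* n)) ⟨
      y ^ p + (p ℕ.* n) × (v + h * z)              ∎)
      where
      -- The quotient of `(n h)^p = n² h² (n h)^(p-2)` by `p n`, where `n = m p`; a prime is at
      -- least 2, so two factors can be split off.
      v = m × (h * (h * (n × h) ^ (p ∸ 2)))
      ^p-multiple : ∀ q → q ≡ p → (n × h) ^ q ≈ (p ℕ.* n) × (m × (h * (h * (n × h) ^ (q ∸ 2))))
      ^p-multiple zero ≡.refl with () ← prime⇒nonTrivial p-prime
      ^p-multiple (suc zero) ≡.refl with () ← prime⇒nonTrivial p-prime
      ^p-multiple (suc (suc q)) _ = begin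
        n × h * (n × h * r)         ≈⟨ ×-assoc-* n h _ ⟩
        n × (h * (n × h * r))       ≈⟨ ×-congʳ n (*-congˡ (×-assoc-* n h r)) ⟩
        n × (h * (n × (h * r)))     ≈⟨ ×-congʳ n (×-comm-* n h _) ⟩
        n × n × (h * (h * r))       ≈⟨ ×-assocˡ _ n n ⟩
        (n ℕ.* n) × (h * (h * r))   ≈⟨ ×-congˡ (≡.trans (cong (n ℕ.*_) n≡m*p) (shuffle n m p)) ⟩
        (p ℕ.* n ℕ.* m) × (h * (h * r)) ≈⟨ ×-assocˡ _ (p ℕ.* n) m ⟨
        (p ℕ.* n) × m × (h * (h * r)) ∎
        where
        r = (n × h) ^ q
        shuffle : ∀ a b c → a ℕ.* (b ℕ.* c) ≡ c ℕ.* a ℕ.* b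
        shuffle = ℕ-Solver.solve-∀

-- The commutative semiring of Laurent polynomials.

open import Data.Nat using (_^_)
open import Data.Product using (_×_)
open ≡ using (refl; sym; trans)

infixl 6 _⊕_
_⊕_ : Vec ℤ d → Vec ℤ d → Vec ℤ d
_⊕_ = zipWith ℤ._+_

_≟ᵛ_ : DecidableEquality (Vec ℤ d)
_≟ᵛ_ = Vec.≡-dec ℤ._≟_

-- The linear functional taking the value `φ e` at the monomial with exponent `e`.
eval : (Vec ℤ d → ℤ) → LPoly d → ℤ
eval φ []            = 0ℤ
eval φ ((e , c) ∷ F) = c ℤ.* φ e ℤ.+ eval φ F

eval-cong : {φ ψ : Vec ℤ d → ℤ} → (∀ e → φ e ≡ ψ e) → ∀ F → eval φ F ≡ eval ψ F
eval-cong φ≗ψ []            = refl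
eval-cong φ≗ψ ((e , c) ∷ F) = cong₂ (λ a b → c ℤ.* a ℤ.+ b) (φ≗ψ e) (eval-cong φ≗ψ F)

eval-zero : (F : LPoly d) → eval (λ _ → 0ℤ) F ≡ 0ℤ
eval-zero []            = refl
eval-zero ((e , c) ∷ F) = cong₂ ℤ._+_ (ℤ.*-zeroʳ c) (eval-zero F)

eval-+ : (φ ψ : Vec ℤ d → ℤ) → ∀ F → eval (λ e → φ e ℤ.+ ψ e) F ≡ eval φ F ℤ.+ eval ψ F
eval-+ φ ψ []            = refl
eval-+ φ ψ ((e , c) ∷ F) rewrite eval-+ φ ψ F = shuffle c (φ e) (ψ e) _ _
  where
  shuffle : ∀ c x y a b → c ℤ.* (x ℤ.+ y) ℤ.+ (a ℤ.+ b) ≡ c ℤ.* x ℤ.+ a ℤ.+ (c ℤ.* y ℤ.+ b)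
  shuffle = ℤ-Solver.solve-∀

eval-* : ∀ a (φ : Vec ℤ d → ℤ) F → eval (λ e → a ℤ.* φ e) F ≡ a ℤ.* eval φ F
eval-* a φ []            = sym (ℤ.*-zeroʳ a)
eval-* a φ ((e , c) ∷ F) rewrite eval-* a φ F = shuffle a c (φ e) _
  where
  shuffle : ∀ a c x y → c ℤ.* (a ℤ.* x) ℤ.+ a ℤ.* y ≡ a ℤ.* (c ℤ.* x ℤ.+ y)
  shuffle = ℤ-Solver.solve-∀

eval-++ : (φ : Vec ℤ d → ℤ) → ∀ F G → eval φ (F ++ G) ≡ eval φ F ℤ.+ eval φ G
eval-++ φ []            G = sym (ℤ.+-identityˡ _)
eval-++ φ ((e , c) ∷ F) G rewrite eval-++ φ F G = sym (ℤ.+-assoc (c ℤ.* φ e) _ _)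

-- Turns a product into an iterated sum, so that associativity and commutativity of `_*L_` reduce to
-- those of adding exponents, together with the exchange of sums in `eval-swap`.
eval-*L : (φ : Vec ℤ d → ℤ) → ∀ F G → eval φ (F *L G) ≡ eval (λ e → eval (λ f → φ (e ⊕ f)) G) F
eval-*L φ []            G = refl
eval-*L φ ((e , c) ∷ F) G =
  trans (eval-++ φ (List.map _ G) (F *L G)) (cong₂ ℤ._+_ (eval-shift G) (eval-*L φ F G))
  where
  shuffle : ∀ c b x y → c ℤ.* b ℤ.* x ℤ.+ c ℤ.* y ≡ c ℤ.* (b ℤ.* x ℤ.+ y)
  shuffle = ℤ-Solver.solve-∀
  eval-shift : ∀ G → eval φ (List.map (λ s → e ⊕ proj₁ s , c ℤ.* proj₂ s) G)
                     ≡ c ℤ.* eval (λ f → φ (e ⊕ f)) G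
  eval-shift []            = sym (ℤ.*-zeroʳ c)
  eval-shift ((f , b) ∷ G) rewrite eval-shift G = shuffle c b (φ (e ⊕ f)) _

eval-swap : (φ : Vec ℤ d → Vec ℤ d → ℤ) → ∀ F G →
            eval (λ e → eval (φ e) G) F ≡ eval (λ f → eval (λ e → φ e f) F) G
eval-swap φ []            G = sym (eval-zero G)
eval-swap φ ((e , c) ∷ F) G = begin
  c ℤ.* eval (φ e) G ℤ.+ eval (λ e → eval (φ e) G) F
    ≡⟨ cong₂ ℤ._+_ (sym (eval-* c (φ e) G)) (eval-swap φ F G) ⟩
  eval (λ f → c ℤ.* φ e f) G ℤ.+ eval (λ f → eval (λ e → φ e f) F) G
    ≡⟨ eval-+ _ _ G ⟨
  eval (λ f → c ℤ.* φ e f ℤ.+ eval (λ e → φ e f) F) G ∎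
  where open ≡-Reasoning

-- Quantifying over all functionals instead of over coefficients makes
-- substitution inside a product immediate; coefficients are a special case.
infix 4 _≋_
record _≋_ (F G : LPoly d) : Set where
  constructor mk≋
  field eval-≡ : ∀ φ → eval φ F ≡ eval φ G
open _≋_

*L-oneʳ : (F : LPoly d) → F *L oneL ≡ F
*L-oneʳ []            = refl
*L-oneʳ ((e , c) ∷ F) =
  cong₂ _∷_ (cong₂ _,_ (Vec.zipWith-identityʳ ℤ.+-identityʳ e) (ℤ.*-identityʳ c)) (*L-oneʳ F)

*L-assoc : (F G H : LPoly d) → (F *L G) *L H ≋ F *L (G *L H)
*L-assoc F G H = mk≋ λ φ → begin
  eval φ ((F *L G) *L H)                         ≡⟨ eval-*L φ (F *L G) H ⟩
  eval (λ e → eval (λ h → φ (e ⊕ h)) H) (F *L G) ≡⟨ eval-*L _ F G ⟩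
  eval (λ e → eval (λ f → eval (λ h → φ (e ⊕ f ⊕ h)) H) G) F
    ≡⟨ eval-cong (λ e → eval-cong (λ f → eval-cong (λ h →
         cong φ (Vec.zipWith-assoc ℤ.+-assoc e f h)) H) G) F ⟩
  eval (λ e → eval (λ f → eval (λ h → φ (e ⊕ (f ⊕ h))) H) G) F
    ≡⟨ eval-cong (λ e → eval-*L _ G H) F ⟨
  eval (λ e → eval (λ g → φ (e ⊕ g)) (G *L H)) F ≡⟨ eval-*L φ F (G *L H) ⟨
  eval φ (F *L (G *L H))                         ∎
  where open ≡-Reasoning

*L-comm : (F G : LPoly d) → F *L G ≋ G *L F
*L-comm F G = mk≋ λ φ → begin
  eval φ (F *L G)                        ≡⟨ eval-*L φ F G ⟩
  eval (λ e → eval (λ f → φ (e ⊕ f)) G) F ≡⟨ eval-swap _ F G ⟩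
  eval (λ f → eval (λ e → φ (e ⊕ f)) F) G
    ≡⟨ eval-cong (λ f → eval-cong (λ e → cong φ (Vec.zipWith-comm ℤ.+-comm e f)) F) G ⟩
  eval (λ f → eval (λ e → φ (f ⊕ e)) F) G ≡⟨ eval-*L φ G F ⟨
  eval φ (G *L F)                        ∎
  where open ≡-Reasoning

*L-cong : {F F′ G G′ : LPoly d} → F ≋ F′ → G ≋ G′ → F *L G ≋ F′ *L G′
*L-cong {F = F} {F′} {G} {G′} F≋F′ G≋G′ = mk≋ λ φ → begin
  eval φ (F *L G)                          ≡⟨ eval-*L φ F G ⟩
  eval (λ e → eval (λ f → φ (e ⊕ f)) G) F   ≡⟨ eval-cong (λ e → eval-≡ G≋G′ _) F ⟩
  eval (λ e → eval (λ f → φ (e ⊕ f)) G′) F  ≡⟨ eval-≡ F≋F′ _ ⟩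
  eval (λ e → eval (λ f → φ (e ⊕ f)) G′) F′ ≡⟨ eval-*L φ F′ G′ ⟨
  eval φ (F′ *L G′)                        ∎
  where open ≡-Reasoning

*L-distribʳ-++ : (H F G : LPoly d) → (F ++ G) *L H ≡ F *L H ++ G *L H
*L-distribʳ-++ H F G = List.concatMap-++ _ F G

LPoly-commutativeSemiring : ℕ → CommutativeSemiring _ _
LPoly-commutativeSemiring d = record
  { Carrier = LPoly d
  ; _≈_ = _≋_
  ; _+_ = _++_
  ; _*_ = _*L_
  ; 0# = []
  ; 1# = oneL
  ; isCommutativeSemiring = IsCommutativeSemiringˡ.isCommutativeSemiring record
    { +-isCommutativeMonoid = IsCommutativeMonoidˡ.isCommutativeMonoid record
      { isSemigroup = record
        { isMagma = record
          { isEquivalence = ≋-isEquivalence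
          ; ∙-cong = λ {F} {F′} {G} {G′} F≋F′ G≋G′ → mk≋ λ φ →
              trans (eval-++ φ F G)
                (trans (cong₂ ℤ._+_ (eval-≡ F≋F′ φ) (eval-≡ G≋G′ φ)) (sym (eval-++ φ F′ G′))) }
        ; assoc = λ F G H → reflexive (List.++-assoc F G H) }
      ; identityˡ = λ F → reflexive refl
      ; comm = λ F G → mk≋ λ φ →
          trans (eval-++ φ F G) (trans (ℤ.+-comm (eval φ F) _) (sym (eval-++ φ G F))) }
    ; *-isCommutativeMonoid = IsCommutativeMonoidˡ.isCommutativeMonoid record
      { isSemigroup = record
        { isMagma = record { isEquivalence = ≋-isEquivalence ; ∙-cong = *L-cong }
        ; assoc = *L-assoc }
      ; identityˡ = λ F → mk≋ λ φ → trans (eval-≡ (*L-comm oneL F) φ) (cong (eval φ) (*L-oneʳ F))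
      ; comm = *L-comm }
    ; distribʳ = λ H F G → reflexive (*L-distribʳ-++ H F G)
    ; zeroˡ = λ F → reflexive refl
    }
  }
  where
  reflexive : {F G : LPoly d} → F ≡ G → F ≋ G
  reflexive F≡G = mk≋ λ φ → cong (eval φ) F≡G
  ≋-isEquivalence : IsEquivalence (_≋_ {d})
  ≋-isEquivalence = record
    { refl = reflexive refl
    ; sym = λ F≋G → mk≋ λ φ → sym (eval-≡ F≋G φ)
    ; trans = λ F≋G G≋H → mk≋ λ φ → trans (eval-≡ F≋G φ) (eval-≡ G≋H φ) }

-- Coefficients, and the two forms of congruence modulo N.

δ : Vec ℤ d → Vec ℤ d → ℤ
δ k e with e ≟ᵛ k
... | yes _ = 1ℤ
... | no  _ = 0ℤ

coeff≡eval-δ : ∀ (F : LPoly d) k → coeff F k ≡ eval (δ k) F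
coeff≡eval-δ []            k = refl
coeff≡eval-δ ((e , c) ∷ F) k with e ≟ᵛ k
... | yes _ = cong₂ ℤ._+_ (sym (ℤ.*-identityʳ c)) (coeff≡eval-δ F k)
... | no  _ = trans (sym (ℤ.+-identityˡ _)) (cong₂ ℤ._+_ (sym (ℤ.*-zeroʳ c)) (coeff≡eval-δ F k))

coeff-++ : ∀ (F G : LPoly d) k → coeff (F ++ G) k ≡ coeff F k ℤ.+ coeff G k
coeff-++ F G k rewrite coeff≡eval-δ (F ++ G) k | coeff≡eval-δ F k | coeff≡eval-δ G k = eval-++ (δ k) F G

terms : (Vec ℤ d → ℤ) → List (Vec ℤ d) → LPoly d
terms a = List.map (λ e → e , a e)

eval-terms-cong : ∀ (φ : Vec ℤ d → ℤ) {a b} E → All (λ e → a e ≡ b e) E →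
                  eval φ (terms a E) ≡ eval φ (terms b E)
eval-terms-cong φ []      []          = refl
eval-terms-cong φ (e ∷ E) (a≡b ∷ a≗b) =
  cong₂ (λ x y → x ℤ.* φ e ℤ.+ y) a≡b (eval-terms-cong φ E a≗b)

eval-terms-zero : ∀ (φ : Vec ℤ d → ℤ) E → eval φ (terms (λ _ → 0ℤ) E) ≡ 0ℤ
eval-terms-zero φ []      = refl
eval-terms-zero φ (e ∷ E) = trans (ℤ.+-identityˡ _) (eval-terms-zero φ E)

eval-terms-+ : ∀ (φ : Vec ℤ d → ℤ) a b E →
  eval φ (terms (λ e → a e ℤ.+ b e) E) ≡ eval φ (terms a E) ℤ.+ eval φ (terms b E)
eval-terms-+ φ a b []      = refl
eval-terms-+ φ a b (e ∷ E) rewrite eval-terms-+ φ a b E = shuffle (a e) (b e) (φ e) _ _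
  where
  shuffle : ∀ a b c x y → (a ℤ.+ b) ℤ.* c ℤ.+ (x ℤ.+ y) ≡ a ℤ.* c ℤ.+ x ℤ.+ (b ℤ.* c ℤ.+ y)
  shuffle = ℤ-Solver.solve-∀

eval-terms-* : ∀ (φ : Vec ℤ d → ℤ) a n E →
  eval φ (terms (λ e → a e ℤ.* n) E) ≡ n ℤ.* eval φ (terms a E)
eval-terms-* φ a n []      = sym (ℤ.*-zeroʳ n)
eval-terms-* φ a n (e ∷ E) rewrite eval-terms-* φ a n E = shuffle (a e) n (φ e) _
  where
  shuffle : ∀ a n c x → a ℤ.* n ℤ.* c ℤ.+ n ℤ.* x ≡ n ℤ.* (a ℤ.* c ℤ.+ x)
  shuffle = ℤ-Solver.solve-∀

coeff-monomial-≡ : ∀ (e : Vec ℤ d) c → coeff ((e , c) ∷ []) e ≡ c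
coeff-monomial-≡ e c with e ≟ᵛ e
... | yes _  = ℤ.+-identityʳ c
... | no e≢e = contradiction refl e≢e

coeff-monomial-≢ : ∀ {e k : Vec ℤ d} c → e ≢ k → coeff ((e , c) ∷ []) k ≡ 0ℤ
coeff-monomial-≢ {e = e} {k} c e≢k with e ≟ᵛ k
... | yes e≡k = contradiction e≡k e≢k
... | no _    = refl

eval-terms-monomial : ∀ (φ : Vec ℤ d → ℤ) e c {E} → Unique E → e ∈ E →
  eval φ (terms (coeff ((e , c) ∷ [])) E) ≡ c ℤ.* φ e
eval-terms-monomial φ e c {.e ∷ E} (e∉E ∷ _) (here refl) = begin
  coeff ((e , c) ∷ []) e ℤ.* φ e ℤ.+ eval φ (terms (coeff ((e , c) ∷ [])) E)
    ≡⟨ cong₂ (λ x y → x ℤ.* φ e ℤ.+ y) (coeff-monomial-≡ e c)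
         (trans (eval-terms-cong φ E (All.map (coeff-monomial-≢ c) e∉E)) (eval-terms-zero φ E)) ⟩
  c ℤ.* φ e ℤ.+ 0ℤ
    ≡⟨ ℤ.+-identityʳ _ ⟩
  c ℤ.* φ e ∎
  where open ≡-Reasoning
eval-terms-monomial φ e c {k ∷ E} (k∉E ∷ unique) (there e∈E)
  rewrite coeff-monomial-≢ c (λ e≡k → All.lookup k∉E e∈E (sym e≡k)) =
  trans (ℤ.+-identityˡ _) (eval-terms-monomial φ e c unique e∈E)

-- Collecting like terms does not change a polynomial. The induction removes one monomial of `F` at
-- a time while `E` stays fixed, which is why `E` need only contain the exponents of `F`.
eval-terms-coeff : ∀ (φ : Vec ℤ d → ℤ) (F : LPoly d) {E} → Unique E →
  (∀ {e} → e ∈ List.map proj₁ F → e ∈ E) → eval φ (terms (coeff F) E) ≡ eval φ F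
eval-terms-coeff φ []            {E} unique covers = eval-terms-zero φ E
eval-terms-coeff φ ((e , c) ∷ F) {E} unique covers = begin
  eval φ (terms (coeff ((e , c) ∷ F)) E)
    ≡⟨ eval-terms-cong φ E (All.universal (coeff-++ ((e , c) ∷ []) F) E) ⟩
  eval φ (terms (λ k → coeff ((e , c) ∷ []) k ℤ.+ coeff F k) E)
    ≡⟨ eval-terms-+ φ _ _ E ⟩
  eval φ (terms (coeff ((e , c) ∷ [])) E) ℤ.+ eval φ (terms (coeff F) E)
    ≡⟨ cong₂ ℤ._+_ (eval-terms-monomial φ e c unique (covers (here refl)))
                   (eval-terms-coeff φ F unique (covers ∘ there)) ⟩
  c ℤ.* φ e ℤ.+ eval φ F ∎
  where open ≡-Reasoning

module _ {d : ℕ} where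
  open CommutativeSemiring (LPoly-commutativeSemiring d) public
    using () renaming (refl to ≋-refl; sym to ≋-sym; trans to ≋-trans; reflexive to ≋-reflexive)
  open import Algebra.Properties.Semiring.Mult
    (CommutativeSemiring.semiring (LPoly-commutativeSemiring d)) public
    using () renaming (_×_ to _×L_)
  open import Algebra.Properties.Semiring.Exp
    (CommutativeSemiring.semiring (LPoly-commutativeSemiring d)) public
    using () renaming (_^_ to _^ᴸ_)
  open Congruence (LPoly-commutativeSemiring d) public

eval-×L : ∀ (φ : Vec ℤ d → ℤ) n F → eval φ (n ×L F) ≡ + n ℤ.* eval φ F
eval-×L φ zero    F = refl
eval-×L φ (suc n) F rewrite eval-++ φ F (n ×L F) | eval-×L φ n F = sym (ℤ.suc-* (+ n) (eval φ F))

eval-neg : ∀ (φ : Vec ℤ d → ℤ) F → eval φ (List.map (λ t → proj₁ t , ℤ.- proj₂ t) F) ≡ ℤ.- eval φ F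
eval-neg φ []            = refl
eval-neg φ ((e , c) ∷ F) rewrite eval-neg φ F = shuffle c (φ e) _
  where
  shuffle : ∀ c x y → ℤ.- c ℤ.* x ℤ.+ ℤ.- y ≡ ℤ.- (c ℤ.* x ℤ.+ y)
  shuffle = ℤ-Solver.solve-∀

-- Collecting the terms of F - G by exponent makes every coefficient of the
-- list itself, not just the sums, divisible by N.
≈⇒mod : ∀ {F G : LPoly d} → F ≈[ N ] G → F ≡ G [mod N ]
≈⇒mod {d} {N} {F} {G} F≈G = terms q E , mk≋ λ φ → begin
  eval φ F                                   ≡⟨ shuffle (eval φ F) (eval φ G) ⟩
  eval φ G ℤ.+ (eval φ F ℤ.+ ℤ.- eval φ G)   ≡⟨ cong (ℤ._+_ (eval φ G)) (eval-D φ) ⟨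
  eval φ G ℤ.+ eval φ D                      ≡⟨ cong (ℤ._+_ (eval φ G)) (eval-terms-coeff φ D (deduplicate-! _≟ᵛ_ _) (∈-deduplicate⁺ _≟ᵛ_)) ⟨
  eval φ G ℤ.+ eval φ (terms (coeff D) E)    ≡⟨ cong (ℤ._+_ (eval φ G)) (eval-terms-cong φ E (All.universal (λ k → Signed._∣_.equality (N∣D k)) E)) ⟩
  eval φ G ℤ.+ eval φ (terms (λ k → q k ℤ.* + N) E) ≡⟨ cong (ℤ._+_ (eval φ G)) (eval-terms-* φ q (+ N) E) ⟩
  eval φ G ℤ.+ + N ℤ.* eval φ (terms q E)    ≡⟨ cong (ℤ._+_ (eval φ G)) (eval-×L φ N (terms q E)) ⟨
  eval φ G ℤ.+ eval φ (N ×L terms q E)       ≡⟨ eval-++ φ G _ ⟨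
  eval φ (G ++ N ×L terms q E)               ∎
  where
  open ≡-Reasoning
  D = F ++ List.map (λ t → proj₁ t , ℤ.- proj₂ t) G
  E = deduplicate _≟ᵛ_ (List.map proj₁ D)
  eval-D : ∀ φ → eval φ D ≡ eval φ F ℤ.+ ℤ.- eval φ G
  eval-D φ = trans (eval-++ φ F _) (cong (ℤ._+_ (eval φ F)) (eval-neg φ G))
  N∣D : ∀ k → + N Signed.∣ coeff D k
  N∣D k = subst (+ N Signed.∣_)
    (trans (cong₂ ℤ._-_ (coeff≡eval-δ F k) (coeff≡eval-δ G k))
           (sym (trans (coeff≡eval-δ D k) (eval-D (δ k)))))
    (Signed.∣ᵤ⇒∣ (F≈G k))
  q : Vec ℤ d → ℤ
  q k = Signed._∣_.quotient (N∣D k)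
  shuffle : ∀ x y → x ≡ y ℤ.+ (x ℤ.+ ℤ.- y)
  shuffle = ℤ-Solver.solve-∀

mod⇒≈ : ∀ {F G : LPoly d} → F ≡ G [mod N ] → F ≈[ N ] G
mod⇒≈ {N = N} {F} {G} (H , F≋G+NH) k = Signed.∣⇒∣ᵤ (Signed.divides (eval (δ k) H) (begin
  coeff F k ℤ.- coeff G k                                   ≡⟨ cong₂ ℤ._-_ (coeff≡eval-δ F k) (coeff≡eval-δ G k) ⟩
  eval (δ k) F ℤ.- eval (δ k) G                             ≡⟨ cong (ℤ._- eval (δ k) G) (trans (eval-≡ F≋G+NH (δ k)) (eval-++ (δ k) G _)) ⟩
  eval (δ k) G ℤ.+ eval (δ k) (N ×L H) ℤ.- eval (δ k) G     ≡⟨ cong (λ x → eval (δ k) G ℤ.+ x ℤ.- eval (δ k) G) (eval-×L (δ k) N H) ⟩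
  eval (δ k) G ℤ.+ + N ℤ.* eval (δ k) H ℤ.- eval (δ k) G    ≡⟨ shuffle (eval (δ k) G) (+ N) (eval (δ k) H) ⟩
  eval (δ k) H ℤ.* + N                                      ∎))
  where
  open ≡-Reasoning
  shuffle : ∀ x n y → x ℤ.+ n ℤ.* y ℤ.- x ≡ y ℤ.* n
  shuffle = ℤ-Solver.solve-∀

-- The substitution of x^p for x, and the Cartier operator.

infixr 7 _·_
_·_ : ℕ → Vec ℤ d → Vec ℤ d
n · e = Vec.map (ℤ._*_ (+ n)) e

·-⊕ : ∀ n (e f : Vec ℤ d) → n · (e ⊕ f) ≡ n · e ⊕ n · f
·-⊕ n []      []      = refl
·-⊕ n (x ∷ e) (y ∷ f) = cong₂ _∷_ (ℤ.*-distribˡ-+ (+ n) x y) (·-⊕ n e f)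

0·e : (e : Vec ℤ d) → 0 · e ≡ replicate d 0ℤ
0·e []      = refl
0·e (x ∷ e) = cong (0ℤ ∷_) (0·e e)

[1+n]·e : ∀ n (e : Vec ℤ d) → suc n · e ≡ e ⊕ n · e
[1+n]·e n []      = refl
[1+n]·e n (x ∷ e) = cong₂ _∷_ (ℤ.suc-* (+ n) x) ([1+n]·e n e)

n·0 : ∀ n d → n · replicate d 0ℤ ≡ replicate d 0ℤ
n·0 n d = trans (Vec.map-replicate _ 0ℤ d) (cong (replicate d) (ℤ.*-zeroʳ (+ n)))

·-injective : ∀ n .{{_ : NonZero n}} {e f : Vec ℤ d} → n · e ≡ n · f → e ≡ f
·-injective n {[]}    {[]}    _  = refl
·-injective n@(suc _) {x ∷ e} {y ∷ f} eq =
  cong₂ _∷_ (ℤ.*-cancelˡ-≡ (+ n) x y (cong Vec.head eq)) (·-injective n (cong Vec.tail eq))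

module _ (p : ℕ) where

  eval-expand : ∀ (φ : Vec ℤ d → ℤ) F → eval φ (expand p F) ≡ eval (λ e → φ (p · e)) F
  eval-expand φ []            = refl
  eval-expand φ ((e , c) ∷ F) = cong (ℤ._+_ (c ℤ.* φ (p · e))) (eval-expand φ F)

  expand-cong : {F G : LPoly d} → F ≋ G → expand p F ≋ expand p G
  expand-cong {F = F} {G} F≋G = mk≋ λ φ →
    trans (eval-expand φ F) (trans (eval-≡ F≋G _) (sym (eval-expand φ G)))

  expand-×L : ∀ n (F : LPoly d) → expand p (n ×L F) ≡ n ×L expand p F
  expand-×L zero    F = refl
  expand-×L (suc n) F = trans (List.map-++ _ F (n ×L F)) (cong (expand p F ++_) (expand-×L n F))

  expand-mod : {F G : LPoly d} → F ≡ G [mod N ] → expand p F ≡ expand p G [mod N ]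
  expand-mod {N = N} {F} {G} (H , F≋G+NH) = expand p H ,
    ≋-trans (expand-cong F≋G+NH)
      (≋-reflexive (trans (List.map-++ _ G (N ×L H)) (cong (expand p G ++_) (expand-×L N H))))

  expand-*L : (F G : LPoly d) → expand p (F *L G) ≋ expand p F *L expand p G
  expand-*L F G = mk≋ λ φ → begin
    eval φ (expand p (F *L G))                            ≡⟨ eval-expand φ (F *L G) ⟩
    eval (λ e → φ (p · e)) (F *L G)                       ≡⟨ eval-*L _ F G ⟩
    eval (λ e → eval (λ f → φ (p · (e ⊕ f))) G) F         ≡⟨ eval-cong (λ e → eval-cong (λ f → cong φ (·-⊕ p e f)) G) F ⟩
    eval (λ e → eval (λ f → φ (p · e ⊕ p · f)) G) F       ≡⟨ eval-cong (λ e → eval-expand _ G) F ⟨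
    eval (λ e → eval (λ f → φ (p · e ⊕ f)) (expand p G)) F ≡⟨ eval-expand _ F ⟨
    eval (λ e → eval (λ f → φ (e ⊕ f)) (expand p G)) (expand p F) ≡⟨ eval-*L φ (expand p F) (expand p G) ⟨
    eval φ (expand p F *L expand p G)                     ∎
    where open ≡-Reasoning

  expand-^L : ∀ (F : LPoly d) n → expand p (F ^L n) ≋ expand p F ^L n
  expand-^L F zero    = ≋-reflexive (cong (λ e → (e , 1ℤ) ∷ []) (n·0 p _))
  expand-^L F (suc n) = ≋-trans (expand-*L F (F ^L n)) (*L-cong (≋-refl {x = expand p F}) (expand-^L F n))

  module _ .{{_ : NonZero p}} where

    coeff-expand : ∀ (F : LPoly d) k → coeff (expand p F) (p · k) ≡ coeff F k
    coeff-expand []            k = refl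
    coeff-expand ((e , c) ∷ F) k with (p · e) ≟ᵛ (p · k) | e ≟ᵛ k
    ... | yes _     | yes _   = cong (ℤ._+_ c) (coeff-expand F k)
    ... | no _      | no _    = coeff-expand F k
    ... | yes pe≡pk | no e≢k  = contradiction (·-injective p pe≡pk) e≢k
    ... | no pe≢pk  | yes e≡k = contradiction (cong (p ·_) e≡k) pe≢pk

    -- The coefficients of `F` and `G` reappear at the exponents `p · k`. Consequently the `P̂` of a
    -- contraction is unique modulo `N`.
    expand-mod-injective : {F G : LPoly d} → expand p F ≡ expand p G [mod N ] → F ≡ G [mod N ]
    expand-mod-injective {N = N} {F} {G} eq = ≈⇒mod λ k →
      subst (λ z → + N Unsigned.∣ z) (cong₂ ℤ._-_ (coeff-expand F k) (coeff-expand G k)) (mod⇒≈ eq (p · k))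

    private
      -- The remainder is a difference of two multiples of `p`, and it is less than `p`.
      [p*z]%p≡0 : ∀ z → (+ p ℤ.* z) %ℕ p ≡ 0
      [p*z]%p≡0 z = n<d∧d∣n⇒n≡0 (ℤ.n%ℕd<d (+ p ℤ.* z) p) (Signed.∣⇒∣ᵤ (Signed.divides (z ℤ.- q) (begin
        + r                              ≡⟨ shuffle₁ (+ r) (q ℤ.* + p) ⟩
        + r ℤ.+ q ℤ.* + p ℤ.- q ℤ.* + p  ≡⟨ cong (ℤ._- q ℤ.* + p) (ℤ.a≡a%ℕn+[a/ℕn]*n (+ p ℤ.* z) p) ⟨
        + p ℤ.* z ℤ.- q ℤ.* + p          ≡⟨ shuffle₂ (+ p) z q ⟩
        (z ℤ.- q) ℤ.* + p                ∎)))
        where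
        open ≡-Reasoning
        q = (+ p ℤ.* z) /ℕ p
        r = (+ p ℤ.* z) %ℕ p
        n<d∧d∣n⇒n≡0 : ∀ {m n} → m < n → n ∣ m → m ≡ 0
        n<d∧d∣n⇒n≡0 {zero}  m<n n∣m = refl
        n<d∧d∣n⇒n≡0 {suc m} m<n n∣m = contradiction (∣⇒≤ n∣m) (ℕ.<⇒≱ m<n)
        shuffle₁ : ∀ x y → x ≡ x ℤ.+ y ℤ.- y
        shuffle₁ = ℤ-Solver.solve-∀
        shuffle₂ : ∀ p z q → p ℤ.* z ℤ.- q ℤ.* p ≡ (z ℤ.- q) ℤ.* p
        shuffle₂ = ℤ-Solver.solve-∀

      [p*z]/p≡z : ∀ z → (+ p ℤ.* z) /ℕ p ≡ z
      [p*z]/p≡z z = ℤ.*-cancelʳ-≡ q z (+ p) (begin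
        q ℤ.* + p                        ≡⟨ ℤ.+-identityˡ _ ⟨
        0ℤ ℤ.+ q ℤ.* + p                 ≡⟨ cong (λ r → + r ℤ.+ q ℤ.* + p) ([p*z]%p≡0 z) ⟨
        + ((+ p ℤ.* z) %ℕ p) ℤ.+ q ℤ.* + p  ≡⟨ ℤ.a≡a%ℕn+[a/ℕn]*n (+ p ℤ.* z) p ⟨
        + p ℤ.* z                        ≡⟨ ℤ.*-comm (+ p) z ⟩
        z ℤ.* + p                        ∎)
        where
        open ≡-Reasoning
        q = (+ p ℤ.* z) /ℕ p

    allDiv-· : (e : Vec ℤ d) → allDiv p (p · e) ≡ true
    allDiv-· []      = refl
    allDiv-· (z ∷ e) rewrite [p*z]%p≡0 z = allDiv-· e

    -- Writes a contracted polynomial as a value of `Λ`, so that the degree axiom for `Λ` applies to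
    -- it in `dg-contract`.
    Λ-expand : (F : LPoly d) → Λ p (expand p F) ≡ F
    Λ-expand []            = refl
    Λ-expand ((e , c) ∷ F) rewrite allDiv-· e = cong₂ (λ f G → (f , c) ∷ G) (begin
      Vec.map (_/ℕ p) (p · e)               ≡⟨ Vec.map-∘ _ _ e ⟨
      Vec.map (λ z → (+ p ℤ.* z) /ℕ p) e    ≡⟨ Vec.map-cong [p*z]/p≡z e ⟩
      Vec.map (λ z → z) e                   ≡⟨ Vec.map-id e ⟩
      e                                     ∎) (Λ-expand F)
      where open ≡-Reasoning

-- Fermat's little theorem and the Frobenius congruence modulo p.

module ℤᶜ = Congruence ℤ.+-*-commutativeSemiring
open import Algebra.Properties.Semiring.Exp (CommutativeSemiring.semiring ℤ.+-*-commutativeSemiring) using () renaming (_^_ to _^ℤ_)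
open import Algebra.Properties.Semiring.Mult (CommutativeSemiring.semiring ℤ.+-*-commutativeSemiring) using () renaming (_×_ to _×ℤ_)

×ℤ≡* : ∀ n c → n ×ℤ c ≡ + n ℤ.* c
×ℤ≡* zero    c = refl
×ℤ≡* (suc n) c = trans (cong (ℤ._+_ c) (×ℤ≡* n c)) (sym (ℤ.suc-* (+ n) c))

1^n≡1 : ∀ n → 1ℤ ^ℤ n ≡ 1ℤ
1^n≡1 zero    = refl
1^n≡1 (suc n) = trans (ℤ.*-identityˡ _) (1^n≡1 n)

0^n≡0 : ∀ n .{{_ : NonZero n}} → 0ℤ ^ℤ n ≡ 0ℤ
0^n≡0 (suc n) = refl

^L≡^ : ∀ (F : LPoly d) n → F ^L n ≡ F ^ᴸ n
^L≡^ F zero    = refl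
^L≡^ F (suc n) = cong (F *L_) (^L≡^ F n)

monomial-^L : ∀ (e : Vec ℤ d) c n → ((e , c) ∷ []) ^L n ≡ (n · e , c ^ℤ n) ∷ []
monomial-^L e c zero    = cong (λ f → (f , 1ℤ) ∷ []) (sym (0·e e))
monomial-^L e c (suc n) rewrite monomial-^L e c n = cong (λ f → (f , c ℤ.* c ^ℤ n) ∷ []) (sym ([1+n]·e n e))

monomial-mod : ∀ (e : Vec ℤ d) {b c} → b ℤᶜ.≡ c [mod N ] → (e , b) ∷ [] ≡ (e , c) ∷ [] [mod N ]
monomial-mod {N = N} e {b} {c} (h ℤᶜ., b≡c+Nh) = (e , h) ∷ [] , mk≋ λ φ → begin
  b ℤ.* φ e ℤ.+ 0ℤ                         ≡⟨ cong (λ x → x ℤ.* φ e ℤ.+ 0ℤ) (trans b≡c+Nh (cong (ℤ._+_ c) (×ℤ≡* N h))) ⟩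
  (c ℤ.+ + N ℤ.* h) ℤ.* φ e ℤ.+ 0ℤ         ≡⟨ shuffle c (+ N) h (φ e) ⟩
  c ℤ.* φ e ℤ.+ 0ℤ ℤ.+ + N ℤ.* (h ℤ.* φ e ℤ.+ 0ℤ)  ≡⟨ cong (ℤ._+_ (c ℤ.* φ e ℤ.+ 0ℤ)) (eval-×L φ N ((e , h) ∷ [])) ⟨
  c ℤ.* φ e ℤ.+ 0ℤ ℤ.+ eval φ (N ×L ((e , h) ∷ [])) ≡⟨ eval-++ φ ((e , c) ∷ []) (N ×L ((e , h) ∷ [])) ⟨
  eval φ ((e , c) ∷ [] ++ N ×L ((e , h) ∷ [])) ∎
  where
  open ≡-Reasoning
  shuffle : ∀ c n h x → (c ℤ.+ n ℤ.* h) ℤ.* x ℤ.+ 0ℤ ≡ c ℤ.* x ℤ.+ 0ℤ ℤ.+ n ℤ.* (h ℤ.* x ℤ.+ 0ℤ)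
  shuffle = ℤ-Solver.solve-∀

module _ {p : ℕ} .{{_ : NonZero p}} (p-prime : Prime p) where

  -- Induction on `n`: modulo `p`, the p-th power of `1 + n` is the sum of the p-th powers.
  fermat-ℕ : ∀ n → (+ n) ^ℤ p ℤᶜ.≡ + n [mod p ]
  fermat-ℕ zero    = ℤᶜ.mod-reflexive (0^n≡0 p)
  fermat-ℕ (suc n) = ℤᶜ.mod-trans (ℤᶜ.mod-frobenius-+ p-prime 1ℤ (+ n))
    (ℤᶜ.mod-+-cong (ℤᶜ.mod-reflexive (1^n≡1 p)) (fermat-ℕ n))

  fermat-ℤ : ∀ c → c ^ℤ p ℤᶜ.≡ c [mod p ]
  fermat-ℤ c = ℤᶜ.mod-trans (ℤᶜ.mod-^-cong p c≡r) (ℤᶜ.mod-trans (fermat-ℕ r) r≡c)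
    where
    r = c %ℕ p
    q = c /ℕ p
    c≡r : c ℤᶜ.≡ + r [mod p ]
    c≡r = q ℤᶜ., (begin
      c                    ≡⟨ ℤ.a≡a%ℕn+[a/ℕn]*n c p ⟩
      + r ℤ.+ q ℤ.* + p    ≡⟨ cong (ℤ._+_ (+ r)) (ℤ.*-comm q (+ p)) ⟩
      + r ℤ.+ + p ℤ.* q    ≡⟨ cong (ℤ._+_ (+ r)) (×ℤ≡* p q) ⟨
      + r ℤ.+ p ×ℤ q       ∎)
      where open ≡-Reasoning
    -- The congruence is one-sided by definition, so this direction has its own witness `- q`.
    r≡c : + r ℤᶜ.≡ c [mod p ]
    r≡c = (ℤ.- q) ℤᶜ., (begin
      + r                                      ≡⟨ shuffle (+ r) q (+ p) ⟩
      + r ℤ.+ q ℤ.* + p ℤ.+ + p ℤ.* (ℤ.- q)    ≡⟨ cong (ℤ._+ + p ℤ.* (ℤ.- q)) (ℤ.a≡a%ℕn+[a/ℕn]*n c p) ⟨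
      c ℤ.+ + p ℤ.* (ℤ.- q)                    ≡⟨ cong (ℤ._+_ c) (×ℤ≡* p (ℤ.- q)) ⟨
      c ℤ.+ p ×ℤ (ℤ.- q)                       ∎)
      where
      open ≡-Reasoning
      shuffle : ∀ r q p → r ≡ r ℤ.+ q ℤ.* p ℤ.+ p ℤ.* (ℤ.- q)
      shuffle = ℤ-Solver.solve-∀

  -- Modulo `p` the p-th power is additive, which reduces the claim to single terms; there the
  -- exponent is multiplied by `p`, and Fermat replaces `c^p` by `c`.
  ^L-frobenius : ∀ (F : LPoly d) → F ^L p ≡ expand p F [mod p ]
  ^L-frobenius []            = mod-reflexive (≋-reflexive ([]^n p))
    where
    []^n : ∀ n .{{_ : NonZero n}} → [] ^L n ≡ []
    []^n (suc n) = refl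
  ^L-frobenius {d} ((e , c) ∷ F) =
    mod-trans (mod-reflexive (≋-reflexive (^L≡^ ((e , c) ∷ F) p)))
      (mod-trans (mod-frobenius-+ p-prime ((e , c) ∷ []) F)
        (mod-+-cong
          (mod-trans (mod-reflexive (≋-reflexive (trans (sym (^L≡^ ((e , c) ∷ []) p)) (monomial-^L e c p))))
            (monomial-mod (p · e) (fermat-ℤ c)))
          (mod-trans (mod-reflexive (≋-reflexive (sym (^L≡^ F p)))) (^L-frobenius F))))

-- Iterated p-th powers and the key congruence modulo prime powers.

mod-sym : {F G : LPoly d} → F ≡ G [mod N ] → G ≡ F [mod N ]
mod-sym {N = N} {F} {G} F≡G = ≈⇒mod λ k →
  subst (N ∣_) (ℤ.∣i-j∣≡∣j-i∣ (coeff F k) (coeff G k)) (mod⇒≈ F≡G k)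

^L-cong : ∀ {F G : LPoly d} n → F ≡ G [mod N ] → F ^L n ≡ G ^L n [mod N ]
^L-cong {F = F} {G} n F≡G rewrite ^L≡^ F n | ^L≡^ G n = mod-^-cong n F≡G

-- The power `F^(p^i)`, built from p-th powers because each of these gains one factor `p` in the
-- modulus.
tower : ℕ → ℕ → LPoly d → LPoly d
tower p zero    F = F
tower p (suc i) F = tower p i F ^L p

-- Starts from the Frobenius congruence modulo `p` and applies `mod-^p-lift` once for each further
-- p-th power; substitution commutes with powers.
tower-frobenius : ∀ {p} .{{_ : NonZero p}} → Prime p → ∀ i (F : LPoly d) →
  tower p (suc i) F ≡ expand p (tower p i F) [mod p ^ suc i ]
tower-frobenius {p = p} p-prime zero F =
  subst (F ^L p ≡ expand p F [mod_]) (sym (ℕ.*-identityʳ p)) (^L-frobenius p-prime F)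
tower-frobenius {p = p} p-prime (suc i) F =
  mod-trans (mod-reflexive (≋-reflexive (^L≡^ (tower p (suc i) F) p)))
    (mod-trans (mod-^p-lift p-prime (m∣m*n (p ^ i)) (tower-frobenius p-prime i F))
      (mod-reflexive (≋-trans (≋-reflexive (sym (^L≡^ (expand p (tower p i F)) p)))
        (≋-sym (expand-^L p (tower p i F) p)))))

-- Substitutes `x^(p^c)` for `x`. The new `expand` is innermost, so a contraction
-- `H ^L p ≡ expand p G` applies directly to `expands p (suc c) G` in `orbit-tower`.
expands : ℕ → ℕ → LPoly d → LPoly d
expands p zero    F = F
expands p (suc c) F = expands p c (expand p F)

expands-cong : ∀ p c {F G : LPoly d} → F ≡ G [mod N ] → expands p c F ≡ expands p c G [mod N ]
expands-cong p zero    F≡G = F≡G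
expands-cong p (suc c) F≡G = expands-cong p c (expand-mod p F≡G)

expands-injective : ∀ p .{{_ : NonZero p}} c {F G : LPoly d} →
  expands p c F ≡ expands p c G [mod N ] → F ≡ G [mod N ]
expands-injective p zero    eq = eq
expands-injective p (suc c) eq = expand-mod-injective p (expands-injective p c eq)

expands-expand : ∀ p c (F : LPoly d) → expands p c (expand p F) ≡ expand p (expands p c F)
expands-expand p zero    F = refl
expands-expand p (suc c) F = expands-expand p c (expand p F)

expands-^L : ∀ p c (F : LPoly d) n → expands p c (F ^L n) ≡ expands p c F ^L n [mod N ]
expands-^L p zero    F n = mod-reflexive ≋-refl
expands-^L p (suc c) F n =
  mod-trans (expands-cong p c (mod-reflexive (expand-^L p F n))) (expands-^L p c (expand p F) n)

-- The sequence of polynomials P_i.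

-- Follows only the first components of states, indexed by the number of steps: neither `k` nor the
-- second component affects them.
data Orbit (p N : ℕ) (P : LPoly d) : ℕ → LPoly d → Set where
  base     : ∀ {G} → G ≡ P [mod N ] → Orbit p N P 0 G
  contract : ∀ {i G H} → Orbit p N P i H → H ^L p ≡ expand p G [mod N ] → Orbit p N P (suc i) G
  power    : ∀ {i G H} → Orbit p N P i H → ¬ (∃[ K ] H ^L p ≡ expand p K [mod N ]) →
             G ≡ H ^L p [mod N ] → Orbit p N P (suc i) G

module _ {p : ℕ} .{{_ : NonZero p}} {P : LPoly d} where

  orbit-resp : ∀ {i G G′} → G ≡ G′ [mod N ] → Orbit p N P i G → Orbit p N P i G′
  orbit-resp G≡G′ (base G≡P)           = base (mod-trans (mod-sym G≡G′) G≡P)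
  orbit-resp G≡G′ (contract o H^p≡)    = contract o (mod-trans H^p≡ (expand-mod p G≡G′))
  orbit-resp G≡G′ (power o irred G≡)   = power o irred (mod-trans (mod-sym G≡G′) G≡)

  -- Congruent predecessors cannot be treated differently, since whether a contraction exists
  -- depends only on the class modulo `N`. So counting polynomials reduces to counting step numbers.
  orbit-unique : ∀ {i G G′} → Orbit p N P i G → Orbit p N P i G′ → G ≡ G′ [mod N ]
  orbit-unique (base G≡P) (base G′≡P) = mod-trans G≡P (mod-sym G′≡P)
  orbit-unique (contract o H^p≡) (contract o′ H′^p≡) = expand-mod-injective p
    (mod-trans (mod-sym H^p≡) (mod-trans (^L-cong p (orbit-unique o o′)) H′^p≡))
  orbit-unique (contract o H^p≡) (power o′ irred _) =
    contradiction (_ , mod-trans (^L-cong p (orbit-unique o′ o)) H^p≡) irred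
  orbit-unique (power o irred _) (contract o′ H′^p≡) =
    contradiction (_ , mod-trans (^L-cong p (orbit-unique o o′)) H′^p≡) irred
  orbit-unique (power o _ G≡) (power o′ _ G′≡) =
    mod-trans G≡ (mod-trans (^L-cong p (orbit-unique o o′)) (mod-sym G′≡))

  -- Here `c` is the number of contractions: each one adds a substitution, whereas a plain p-th
  -- power leaves `c` unchanged.
  orbit-tower : ∀ {i G} → Orbit p N P i G → ∃[ c ] expands p c G ≡ tower p i P [mod N ]
  orbit-tower (base G≡P) = 0 , G≡P
  orbit-tower (contract {H = H} o H^p≡) with c , eq ← orbit-tower o = suc c ,
    mod-trans (mod-sym (expands-cong p c H^p≡)) (mod-trans (expands-^L p c H p) (^L-cong p eq))
  orbit-tower (power {H = H} o _ G≡) with c , eq ← orbit-tower o = c ,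
    mod-trans (expands-cong p c G≡) (mod-trans (expands-^L p c H p) (^L-cong p eq))

  -- `orbit-tower` carries the key congruence for `P^(p^s)` over to `expands p c G`, and injectivity
  -- then cancels the substitution. After `s` steps the modulus is exactly the one that
  -- `tower-frobenius` provides.
  orbit-stable : Prime p → ∀ {s G} → Orbit p (p ^ suc s) P s G → G ^L p ≡ expand p G [mod p ^ suc s ]
  orbit-stable p-prime {s} {G} o with c , eq ← orbit-tower o = expands-injective p c
    (mod-trans (expands-^L p c G p)
      (mod-trans (^L-cong p eq)
        (mod-trans (tower-frobenius p-prime s P)
          (mod-trans (expand-mod p (mod-sym eq))
            (mod-reflexive (≋-reflexive (sym (expands-expand p c G))))))))

-- Degree estimates for a single step.

module _ {d p N : ℕ} .{{_ : NonZero p}} (D : DegreeLike d p N) where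
  open DegreeLike D
  open ℕ.≤-Reasoning

  private
    ≋⇒≈ : {F G : LPoly d} → F ≋ G → F ≈[ N ] G
    ≋⇒≈ F≋G = mod⇒≈ (mod-reflexive F≋G)

  dg-^L : ∀ F n .{{_ : NonZero n}} → dg (F ^L n) ≤ n ℕ.* dg F
  dg-^L F (suc zero) = begin
    dg (F *L oneL)  ≡⟨ cong dg (*L-oneʳ F) ⟩
    dg F            ≡⟨ ℕ.*-identityˡ _ ⟨
    1 ℕ.* dg F      ∎
  dg-^L F (suc n@(suc _)) = begin
    dg (F *L (F ^L n))       ≤⟨ dg-mul F (F ^L n) ⟩
    dg F ℕ.+ dg (F ^L n)     ≤⟨ ℕ.+-monoʳ-≤ (dg F) (dg-^L F n) ⟩
    suc n ℕ.* dg F           ∎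

  -- For k = 0 this is sharper than submultiplicativity, as dg 1 may be positive.
  dg-^L-*L : ∀ F k G → dg ((F ^L k) *L G) ≤ k ℕ.* dg F ℕ.+ dg G
  dg-^L-*L F zero    G = ℕ.≤-reflexive (dg-cong _ _ (≋⇒≈
    (≋-trans (*L-comm oneL G) (≋-reflexive (*L-oneʳ G)))))
  dg-^L-*L F (suc k) G = begin
    dg ((F *L (F ^L k)) *L G)          ≡⟨ dg-cong _ _ (≋⇒≈ (*L-assoc F (F ^L k) G)) ⟩
    dg (F *L ((F ^L k) *L G))          ≤⟨ dg-mul F _ ⟩
    dg F ℕ.+ dg ((F ^L k) *L G)        ≤⟨ ℕ.+-monoʳ-≤ (dg F) (dg-^L-*L F k G) ⟩
    dg F ℕ.+ (k ℕ.* dg F ℕ.+ dg G)     ≡⟨ ℕ.+-assoc (dg F) _ _ ⟨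
    suc k ℕ.* dg F ℕ.+ dg G            ∎

  -- The p-th power multiplies the degree by at most `p`, and `Λ`, which recovers `G`, divides it by
  -- `p` again.
  dg-contract : ∀ F G → F ^L p ≡ expand p G [mod N ] → dg G ≤ dg F
  dg-contract F G F^p≡ = ℕ.*-cancelʳ-≤ (dg G) (dg F) p (begin
    dg G ℕ.* p                  ≡⟨ cong (λ H → dg H ℕ.* p) (Λ-expand p G) ⟨
    dg (Λ p (expand p G)) ℕ.* p ≤⟨ dg-Λ (expand p G) ⟩
    dg (expand p G)             ≡⟨ dg-cong _ _ (mod⇒≈ F^p≡) ⟨
    dg (F ^L p)                 ≤⟨ dg-^L F p ⟩
    p ℕ.* dg F                  ≡⟨ ℕ.*-comm p _ ⟩
    dg F ℕ.* p                  ∎)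

  module _ {F G : LPoly d} {k X m : ℕ} (k<p : k < p) (dgF≤ : dg F ≤ X) (dgG≤ : dg G ℕ.+ 1 ≤ X ℕ.+ m) where

    -- As `k` is at most `p - 1`, the `X` in the bound for `G` completes `k X` to at most `p X`.
    dg-^L-*L-bound : dg ((F ^L k) *L G) ℕ.+ 1 ≤ p ℕ.* X ℕ.+ m
    dg-^L-*L-bound = begin
      dg ((F ^L k) *L G) ℕ.+ 1       ≤⟨ ℕ.+-monoˡ-≤ 1 (dg-^L-*L F k G) ⟩
      k ℕ.* dg F ℕ.+ dg G ℕ.+ 1      ≡⟨ ℕ.+-assoc (k ℕ.* dg F) _ 1 ⟩
      k ℕ.* dg F ℕ.+ (dg G ℕ.+ 1)    ≤⟨ ℕ.+-mono-≤ (ℕ.*-monoʳ-≤ k dgF≤) dgG≤ ⟩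
      k ℕ.* X ℕ.+ (X ℕ.+ m)          ≡⟨ ℕ.+-assoc (k ℕ.* X) X m ⟨
      k ℕ.* X ℕ.+ X ℕ.+ m            ≡⟨ cong (ℕ._+ m) (ℕ.+-comm (k ℕ.* X) X) ⟩
      suc k ℕ.* X ℕ.+ m              ≤⟨ ℕ.+-monoˡ-≤ m (ℕ.*-monoˡ-≤ X k<p) ⟩
      p ℕ.* X ℕ.+ m                  ∎

    -- The `+ 1` makes the previous bound strict: the degree before `Λ` is below `p X + m`, hence
    -- below `p (X + m)`, and strictness survives cancelling `p`.
    dg-Λ-bound : dg (Λ p ((F ^L k) *L G)) ℕ.+ 1 ≤ X ℕ.+ m
    dg-Λ-bound = subst (_≤ X ℕ.+ m) (ℕ.+-comm 1 _) (ℕ.*-cancelʳ-< p _ _ (begin-strict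
      dg (Λ p ((F ^L k) *L G)) ℕ.* p  ≤⟨ dg-Λ _ ⟩
      dg ((F ^L k) *L G)              <⟨ ℕ.≤-reflexive (ℕ.+-comm 1 _) ⟩
      dg ((F ^L k) *L G) ℕ.+ 1        ≤⟨ dg-^L-*L-bound ⟩
      p ℕ.* X ℕ.+ m                   ≤⟨ ℕ.+-monoʳ-≤ (p ℕ.* X) (ℕ.m≤n*m m p) ⟩
      p ℕ.* X ℕ.+ p ℕ.* m             ≡⟨ ℕ.*-distribˡ-+ p X m ⟨
      p ℕ.* (X ℕ.+ m)                 ≡⟨ ℕ.*-comm p _ ⟩
      (X ℕ.+ m) ℕ.* p                 ∎))

-- The invariant along the procedure, and the two bounds.

module _ {p s d : ℕ} .{{_ : NonZero p}} (p-prime : Prime p) (P Q : LPoly d) (D : DegreeLike d p (p ^ suc s)) where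
  open DegreeLike D

  private
    -- Truncated subtraction makes this `max(0, b - a + 1)`.
    m = dg Q ℕ.+ 1 ∸ dg P

    Bounded : ℕ → LPoly d → LPoly d → Set
    Bounded X Pi Qi = dg Pi ≤ X × dg Qi ℕ.+ 1 ≤ X ℕ.+ m

    weaken : ∀ {X Y Pi Qi} → X ≤ Y → Bounded X Pi Qi → Bounded Y Pi Qi
    weaken X≤Y (P≤ , Q≤) = ℕ.≤-trans P≤ X≤Y , ℕ.≤-trans Q≤ (ℕ.+-monoˡ-≤ m X≤Y)

  -- Here `i` is the number of steps capped at `s`, and the degree bounds grow by a factor `p` only
  -- while `i` is below the cap.
  reach-orbit : ∀ {Pi Qi} → Reach p (p ^ suc s) P Q Pi Qi →
    ∃[ i ] i ≤ s × Orbit p (p ^ suc s) P i Pi × Bounded (p ^ i ℕ.* dg P) Pi Qi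
  reach-orbit start = 0 , ℕ.z≤n , base (mod-reflexive ≋-refl) ,
    ℕ.≤-reflexive (sym (ℕ.*-identityˡ _)) ,
    subst (λ a → dg Q ℕ.+ 1 ≤ a ℕ.+ m) (sym (ℕ.*-identityˡ _)) (ℕ.m≤n+m∸n (dg Q ℕ.+ 1) (dg P))
  reach-orbit (stepΛ {Pi} reach k k<p P̂ Pi^p≈)
    with reach-orbit reach | ≈⇒mod {F = Pi ^L p} {expand p P̂} Pi^p≈
  ... | i , i≤s , o , P≤ , Q≤ | Pi^p≡ with ℕ.m≤n⇒m<n∨m≡n i≤s
  ...   | inj₁ i<s  = suc i , i<s , contract o Pi^p≡ , weaken (ℕ.*-monoˡ-≤ (dg P) (ℕ.m≤n*m (p ^ i) p))
          (ℕ.≤-trans (dg-contract D Pi P̂ Pi^p≡) P≤ , dg-Λ-bound D k<p P≤ Q≤)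
  -- At the cap `expand p P̂ ≡ Pi ^L p ≡ expand p Pi`, so `P̂ ≡ Pi`: the polynomial is already the
  -- one of step `s`, and the bound `X` is kept.
  ...   | inj₂ refl = s , ℕ.≤-refl ,
          orbit-resp (expand-mod-injective p (mod-trans (mod-sym (orbit-stable p-prime o)) Pi^p≡)) o ,
          ℕ.≤-trans (dg-contract D Pi P̂ Pi^p≡) P≤ , dg-Λ-bound D k<p P≤ Q≤
  reach-orbit (stepPlain {Pi} {Qi} reach k k<p irred) with reach-orbit reach
  ... | i , i≤s , o , P≤ , Q≤ with ℕ.m≤n⇒m<n∨m≡n i≤s
  -- A plain step cannot occur at the cap, since `Pi` itself is a contraction of `Pi ^L p`.
  ...   | inj₂ refl = contradiction (Pi , mod⇒≈ (orbit-stable p-prime o)) irred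
  ...   | inj₁ i<s  = suc i , i<s ,
          power o (λ (K , Pi^p≡) → irred (K , mod⇒≈ Pi^p≡)) (mod-reflexive ≋-refl) ,
          subst (λ X → Bounded X (Pi ^L p) ((Pi ^L k) *L Qi)) (sym (ℕ.*-assoc p (p ^ i) (dg P)))
            (ℕ.≤-trans (dg-^L D Pi p) (ℕ.*-monoʳ-≤ p P≤) , dg-^L-*L-bound D k<p P≤ Q≤)

  reach-bound : ∀ {Pi Qi} → Reach p (p ^ suc s) P Q Pi Qi → dg Qi ℕ.+ 1 ≤ p ^ s ℕ.* dg P ℕ.+ m
  reach-bound reach with i , i≤s , _ , _ , Q≤ ← reach-orbit reach =
    ℕ.≤-trans Q≤ (ℕ.+-monoˡ-≤ m (ℕ.*-monoˡ-≤ (dg P) (ℕ.^-monoʳ-≤ p i≤s)))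

  -- Pigeonhole on the capped step numbers `0, ..., s`: by `orbit-unique`, equal numbers force
  -- congruent polynomials.
  distinct-≤ : ∀ n (f : Fin n → LPoly d × LPoly d) →
    (∀ i → Reach p (p ^ suc s) P Q (proj₁ (f i)) (proj₂ (f i))) →
    (∀ i j → proj₁ (f i) ≈[ p ^ suc s ] proj₁ (f j) → i ≡ j) → n ≤ suc s
  distinct-≤ n f reach distinct = injective⇒≤ {f = index} λ {i} {j} eq →
    distinct i j (mod⇒≈ (orbit-unique (orbit i) (subst (λ t → Orbit p (p ^ suc s) P t (proj₁ (f j)))
      (sym (trans (sym (toℕ-fromℕ< (time< i))) (trans (cong toℕ eq) (toℕ-fromℕ< (time< j))))) (orbit j))))
    where
    time : Fin n → ℕ
    time i = proj₁ (reach-orbit (reach i))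
    time< : ∀ i → time i < suc s
    time< i = ℕ.s≤s (proj₁ (proj₂ (reach-orbit (reach i))))
    orbit : ∀ i → Orbit p (p ^ suc s) P (time i) (proj₁ (f i))
    orbit i = proj₁ (proj₂ (proj₂ (reach-orbit (reach i))))
    index : Fin n → Fin (suc s)
    index i = fromℕ< (time< i)

open import Data.Nat using (_+_; _*_)

theorem2p4 : (p r d : ℕ) .{{_ : NonZero p}} → Prime p → 1 ≤ r →
    (P Q : LPoly d) → (D : DegreeLike d p (p ^ r)) →
    let open DegreeLike D in
    ((∀ Pi Qi → Reach p (p ^ r) P Q Pi Qi →
        dg Qi + 1 ≤ p ^ (r ∸ 1) * dg P + (dg Q + 1 ∸ dg P))
    ×
    (∀ (n : ℕ) (f : Fin n → LPoly d × LPoly d) →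
        (∀ i → Reach p (p ^ r) P Q (proj₁ (f i)) (proj₂ (f i))) →
        (∀ i j → proj₁ (f i) ≈[ p ^ r ] proj₁ (f j) → i ≡ j) →
        n ≤ r))
-- The hypothesis `1 ≤ r` excludes `r = 0`; for `r = suc s` the exponent `r ∸ 1` reduces to `s`.
theorem2p4 p (suc s) d p-prime 1≤r P Q D =
  (λ Pi Qi → reach-bound {s = s} p-prime P Q D) , distinct-≤ {s = s} p-prime P Q D
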